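{- Let $k,d$ be positive integers with $d\equiv r\pmod k$ for some $0\le r\le k-1$. There exists $n_0=n_0(d,k)$ such that for every $n\ge n_0$ and every family $\mathcal{A}\subset 2^{[n]}$ with $\mathrm{VC}(\triangle\mathcal{A}^k)\le d$, we have $|\mathcal{A}|\le 2^r\binom{n-r}{\le\lfloor d/k\rfloor}$.
   Context: $[n]=\{1,\dots,n\}$. For a family $\mathcal{F}\subset 2^{[n]}$, a set $Y\subset[n]$ is shattered by $\mathcal{F}$ if $\{S\cap Y: S\in\mathcal{F}\}=2^Y$; $\mathrm{VC}(\mathcal{F})$ is the largest cardinality of a set shattered by $\mathcal{F}$. $\triangle$ denotes symmetric difference and $\triangle\mathcal{A}^k=\{S_1\triangle\cdots\triangle S_k: S_i\in\mathcal{A}\ \forall i\in[k]\}$. $\binom{m}{\le t}=\sum_{j=0}^{t}\binom{m}{j}$. -}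

module Defs where

open import Data.Nat using (ℕ; zero; suc; _+_; _≤_)
open import Data.Nat.Combinatorics using (_C_)
open import Data.Bool using (_xor_)
open import Data.Fin.Subset using (Subset; _∩_; _⊆_; ∣_∣; ⊥)
open import Data.Vec using (Vec; zipWith; foldr)
open import Data.Vec.Relation.Unary.All using (All)
open import Data.List using (List)
open import Data.List.Membership.Propositional using (_∈_)
open import Data.Product using (Σ; ∃; _×_)
open import Relation.Binary.PropositionalEquality using (_≡_)

Family : ℕ → Set₁
Family n = Subset n → Set

_△_ : ∀ {n} → Subset n → Subset n → Subset n
S △ T = zipWith _xor_ S T

△-fold : ∀ {n k} → Vec (Subset n) k → Subset n
△-fold = foldr _ _△_ ⊥

△Pow : ∀ {n} → List (Subset n) → ℕ → Family n
△Pow {n} 𝒜 k T = Σ (Vec (Subset n) k) λ Ss → All (_∈ 𝒜) Ss × △-fold Ss ≡ T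

-- Y is shattered by ℱ : every Z ⊆ Y equals S ∩ Y for some S ∈ ℱ
-- (together with S ∩ Y ⊆ Y, which always holds, this is {S ∩ Y : S ∈ ℱ} = 2^Y)
Shattered : ∀ {n} → Family n → Subset n → Set
Shattered ℱ Y = ∀ Z → Z ⊆ Y → ∃ λ S → ℱ S × (S ∩ Y) ≡ Z

VC≤ : ∀ {n} → Family n → ℕ → Set
VC≤ ℱ d = ∀ Y → Shattered ℱ Y → ∣ Y ∣ ≤ d

binom≤ : ℕ → ℕ → ℕ
binom≤ m zero = m C 0
binom≤ m (suc t) = binom≤ m t + m C suc t

{-# OPTIONS --safe #-}
-- Let Down ℱ be the down-set obtained from ℱ by compressing the coordinates
-- one after the other.  It has as many members as ℱ, each of them is shattered
-- by ℱ, and Y ∈ Down ℱ, Z ∈ Down 𝒢 imply Y ∪ Z ∈ Down (ℱ △ 𝒢).  Hence any k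
-- members of A = Down 𝒜 have a union of size at most d = kt + r, r < k.
--
-- Call M heavy if no bounded set U satisfies |S \ U| < t for all S ∈ A with
-- S ⊇ M, and light otherwise; only O(n^(t-1)) members of A contain a given
-- light set.  Given k heavy sets, one can choose members of A containing them
-- that each contribute t new points, so the union of the heavy sets has size at
-- most r.  Thus at most r points are heavy; put them in a set R of size r.
-- If R is heavy, no S ∈ A has t + 1 points outside R, for S and k - 1 members
-- containing R would have too large a union, and the bound follows by counting.
-- If R is light, the members containing R, and those with more than t points
-- outside R, all of which contain one of boundedly many light points, number
-- only O(n^(t-1)), less than the number of S ⊇ R with |S \ R| ≤ t.

module Submission where

open import Defs
open import Data.Nat using (ℕ; _≤_; _*_; _^_; _∸_; NonZero)
open import Data.Nat.DivMod using (_/_; _%_)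
open import Data.Fin.Subset using (Subset)
open import Data.List using (List; length)
open import Data.List.Relation.Unary.Unique.Propositional using (Unique)
open import Data.Product using (∃)

open import Data.Bool using (if_then_else_)
import Data.Bool.Properties as Bool
open import Data.Empty using (⊥-elim)
open import Data.Fin using (Fin; zero; suc)
open import Data.Fin.Properties using (¬Fin0)
open import Data.Fin.Subset using (inside; outside; _∈_; _∉_; _⊆_; ∁; _∩_; _∪_; _─_; ⋃; ∣_∣; ⊥; ⊤; ⁅_⁆)
open import Data.Fin.Subset.Properties
open import Data.List using ([]; _∷_; _++_; map; replicate)
open import Data.List.Membership.Propositional using () renaming (_∈_ to _∈ˡ_)
import Data.List.Membership.DecPropositional as DecMembership
open import Data.List.Properties using (length-++; length-map; length-replicate)
open import Data.List.Relation.Unary.All using (All; []; _∷_) renaming (lookup to lookupAll; map to mapAll)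
import Data.List.Relation.Unary.All.Properties as All
open import Data.List.Relation.Unary.AllPairs using ([]; _∷_)
open import Data.List.Relation.Unary.Any using (here; there)
open import Data.Nat using (zero; suc; _+_; _<_; z≤n; s≤s; s≤s⁻¹; _<?_; _≤?_)
open import Data.Nat.Combinatorics using (_C_; nCk+nC[k+1]≡[n+1]C[k+1])
open import Data.Nat.DivMod using (m≡m%n+[m/n]*n; m%n<n)
open import Data.Nat.Properties hiding (_≟_)
open import Data.Nat.Tactic.RingSolver using (solve-∀)
open import Data.Product using (_×_; _,_; proj₁; proj₂)
open import Data.Sum using (_⊎_; inj₁; inj₂)
open import Data.Vec using ([]; _∷_; here; there; tabulate)
import Data.Vec.Properties as Vec
open import Data.Vec.Relation.Unary.All using ([]; _∷_)
open import Function using (_∘_; id)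
open import Relation.Binary.PropositionalEquality
open import Relation.Nullary using (¬_; Dec; yes; no; does; contradiction)
open import Relation.Nullary.Decidable using (¬?; _×-dec_; decidable-stable)
open import Relation.Unary using (Decidable)
open import Relation.Unary.Properties using (_∪?_; _∩?_; ∁?)

private
  variable
    n : ℕ
    F G H : Family n

-- Counting in decidable families

card : Decidable F → ℕ
card {zero}  F? = if does (F? []) then 1 else 0
card {suc n} F? = card (F? ∘ (outside ∷_)) + card (F? ∘ (inside ∷_))

card-mono : (F? : Decidable F) (G? : Decidable G) → (∀ S → F S → G S) → card F? ≤ card G?
card-mono {zero} F? G? F⊆G with F? [] | G? []
... | yes _ | yes _  = ≤-refl
... | yes p | no ¬q  = contradiction (F⊆G [] p) ¬q
... | no _  | _      = z≤n
card-mono {suc n} F? G? F⊆G =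
  +-mono-≤ (card-mono _ _ (F⊆G ∘ (outside ∷_))) (card-mono _ _ (F⊆G ∘ (inside ∷_)))

-- Kept as an equality because compressing a coordinate replaces the two slices of a family by their
-- union and intersection, and `card-Down` needs the count to survive exactly.
card-∪∩ : (F? : Decidable F) (G? : Decidable G) →
          card (F? ∪? G?) + card (F? ∩? G?) ≡ card F? + card G?
card-∪∩ {zero} F? G? with F? [] | G? []
... | yes _ | yes _ = refl
... | yes _ | no _  = refl
... | no _  | yes _ = refl
... | no _  | no _  = refl
card-∪∩ {suc n} F? G? = begin
  (a + b) + (c + e)  ≡⟨ interchange a b c e ⟩
  (a + c) + (b + e)  ≡⟨ cong₂ _+_ (card-∪∩ F₀? G₀?) (card-∪∩ F₁? G₁?) ⟩
  (card F₀? + card G₀?) + (card F₁? + card G₁?)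
    ≡⟨ interchange (card F₀?) (card G₀?) (card F₁?) (card G₁?) ⟩
  card F? + card G?  ∎
  where
  open ≡-Reasoning
  F₀? = F? ∘ (outside ∷_)
  F₁? = F? ∘ (inside ∷_)
  G₀? = G? ∘ (outside ∷_)
  G₁? = G? ∘ (inside ∷_)
  a = card (F₀? ∪? G₀?)
  b = card (F₁? ∪? G₁?)
  c = card (F₀? ∩? G₀?)
  e = card (F₁? ∩? G₁?)
  interchange : ∀ a b c e → (a + b) + (c + e) ≡ (a + c) + (b + e)
  interchange = solve-∀

card-∪-≤ : (F? : Decidable F) (G? : Decidable G) → card (F? ∪? G?) ≤ card F? + card G?
card-∪-≤ F? G? = ≤-trans (m≤m+n _ _) (≤-reflexive (card-∪∩ F? G?))

card-empty : (F? : Decidable F) → (∀ S → ¬ F S) → card F? ≡ 0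
card-empty {zero} F? ¬F with F? []
... | yes p = contradiction p (¬F [])
... | no _  = refl
card-empty {suc n} F? ¬F =
  cong₂ _+_ (card-empty _ (¬F ∘ (outside ∷_))) (card-empty _ (¬F ∘ (inside ∷_)))

card-nonempty : (F? : Decidable F) → ∀ S → F S → 1 ≤ card F?
card-nonempty F? [] p with F? []
... | yes _ = ≤-refl
... | no ¬p = contradiction p ¬p
card-nonempty F? (outside ∷ S) p = ≤-trans (card-nonempty (F? ∘ (outside ∷_)) S p) (m≤m+n _ _)
card-nonempty F? (inside ∷ S)  p = ≤-trans (card-nonempty (F? ∘ (inside ∷_)) S p) (m≤n+m _ _)

card-disjoint : (F? : Decidable F) (G? : Decidable G) (H? : Decidable H) →
                (∀ S → F S → H S) → (∀ S → G S → H S) → (∀ S → F S → ¬ G S) →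
                card F? + card G? ≤ card H?
card-disjoint F? G? H? F⊆H G⊆H F#G = begin
  card F? + card G?                  ≡⟨ card-∪∩ F? G? ⟨
  card (F? ∪? G?) + card (F? ∩? G?)  ≡⟨ cong (card (F? ∪? G?) +_) (card-empty (F? ∩? G?) λ S (p , q) → F#G S p q) ⟩
  card (F? ∪? G?) + 0                ≡⟨ +-identityʳ _ ⟩
  card (F? ∪? G?)                    ≤⟨ card-mono (F? ∪? G?) H? (λ { S (inj₁ p) → F⊆H S p ; S (inj₂ q) → G⊆H S q }) ⟩
  card H?                            ∎
  where open ≤-Reasoning

_≟_ : (S T : Subset n) → Dec (S ≡ T)
_≟_ = Vec.≡-dec Bool._≟_

_∈ˡ?_ : (S : Subset n) (𝒜 : List (Subset n)) → Dec (S ∈ˡ 𝒜)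
_∈ˡ?_ = DecMembership._∈?_ _≟_

length≤card : (𝒜 : List (Subset n)) → Unique 𝒜 → length 𝒜 ≤ card (_∈ˡ? 𝒜)
length≤card []      _          = z≤n
length≤card (S ∷ 𝒜) (S∉𝒜 ∷ un) = begin
  1 + length 𝒜                   ≤⟨ +-mono-≤ (card-nonempty (_≟ S) S refl) (length≤card 𝒜 un) ⟩
  card (_≟ S) + card (_∈ˡ? 𝒜)    ≤⟨ card-disjoint (_≟ S) (_∈ˡ? 𝒜) (_∈ˡ? (S ∷ 𝒜)) (λ _ → here) (λ _ → there)
                                      (λ { _ refl S∈𝒜 → lookupAll S∉𝒜 S∈𝒜 refl }) ⟩
  card (_∈ˡ? (S ∷ 𝒜))            ∎
  where open ≤-Reasoning

-- Compression to a down-set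

-- The recursion compresses the first coordinate and then the rest: the slice without the first
-- point becomes the union of both slices, the slice with it their intersection.
Down : Family n → Family n
Down F []            = F []
Down F (outside ∷ Y) = Down (λ S → F (outside ∷ S) ⊎ F (inside ∷ S)) Y
Down F (inside ∷ Y)  = Down (λ S → F (outside ∷ S) × F (inside ∷ S)) Y

Down? : Decidable F → Decidable (Down F)
Down? F? []            = F? []
Down? F? (outside ∷ Y) = Down? ((F? ∘ (outside ∷_)) ∪? (F? ∘ (inside ∷_))) Y
Down? F? (inside ∷ Y)  = Down? ((F? ∘ (outside ∷_)) ∩? (F? ∘ (inside ∷_))) Y

card-Down : (F? : Decidable F) → card (Down? F?) ≡ card F?
card-Down {zero}  F? = refl
card-Down {suc n} F? = trans
  (cong₂ _+_ (card-Down ((F? ∘ (outside ∷_)) ∪? (F? ∘ (inside ∷_))))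
             (card-Down ((F? ∘ (outside ∷_)) ∩? (F? ∘ (inside ∷_)))))
  (card-∪∩ (F? ∘ (outside ∷_)) (F? ∘ (inside ∷_)))

Down-mono : (∀ S → F S → G S) → ∀ Y → Down F Y → Down G Y
Down-mono F⊆G []            = F⊆G []
Down-mono F⊆G (outside ∷ Y) = Down-mono
  (λ { S (inj₁ p) → inj₁ (F⊆G _ p) ; S (inj₂ p) → inj₂ (F⊆G _ p) }) Y
Down-mono F⊆G (inside ∷ Y)  = Down-mono (λ S (p , q) → F⊆G _ p , F⊆G _ q) Y

Down-⊥ : ∀ S → F S → Down F ⊥
Down-⊥ []            p = p
Down-⊥ (outside ∷ S) p = Down-⊥ S (inj₁ p)
Down-⊥ (inside ∷ S)  p = Down-⊥ S (inj₂ p)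

-- A set in the intersection of both slices extends with or without the first point, so both traces
-- at that point are realised. If the first point is outside `Y`, an extension by either slice will
-- do.
Down⇒Shattered : ∀ Y → Down F Y → Shattered F Y
Down⇒Shattered []            p [] _ = [] , p , refl
Down⇒Shattered (outside ∷ Y) p (inside ∷ Z) Z⊆Y with () ← Z⊆Y here
Down⇒Shattered (outside ∷ Y) p (outside ∷ Z) Z⊆Y with Down⇒Shattered Y p Z (drop-∷-⊆ Z⊆Y)
... | S , inj₁ q , eq = outside ∷ S , q , cong (outside ∷_) eq
... | S , inj₂ q , eq = inside ∷ S , q , cong (outside ∷_) eq
Down⇒Shattered (inside ∷ Y) p (z ∷ Z) Z⊆Y with Down⇒Shattered Y p Z (drop-∷-⊆ Z⊆Y) | z
... | S , (q , _) , eq | outside = outside ∷ S , q , cong (outside ∷_) eq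
... | S , (_ , q) , eq | inside  = inside ∷ S , q , cong (inside ∷_) eq

_⊕_ : Family n → Family n → Family n
(F ⊕ G) T = ∃ λ S₁ → ∃ λ S₂ → F S₁ × G S₂ × (S₁ △ S₂) ≡ T

-- Adding a fixed bit modulo 2 permutes the two bits. So if one summand offers both bits at the
-- first point, the sums do as well, whichever bit the other summand has.
Down-⊕ : ∀ Y Z → Down F Y → Down G Z → Down (F ⊕ G) (Y ∪ Z)
Down-⊕ [] [] p q = [] , [] , p , q , refl
Down-⊕ (outside ∷ Y) (outside ∷ Z) p q = Down-mono
  (λ { _ (S , T , inj₁ a , inj₁ b , refl) → inj₁ (_ , _ , a , b , refl)
     ; _ (S , T , inj₁ a , inj₂ b , refl) → inj₂ (_ , _ , a , b , refl)
     ; _ (S , T , inj₂ a , inj₁ b , refl) → inj₂ (_ , _ , a , b , refl)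
     ; _ (S , T , inj₂ a , inj₂ b , refl) → inj₁ (_ , _ , a , b , refl) })
  (Y ∪ Z) (Down-⊕ Y Z p q)
Down-⊕ (outside ∷ Y) (inside ∷ Z) p q = Down-mono
  (λ { _ (S , T , inj₁ a , (b₀ , b₁) , refl) → (_ , _ , a , b₀ , refl) , (_ , _ , a , b₁ , refl)
     ; _ (S , T , inj₂ a , (b₀ , b₁) , refl) → (_ , _ , a , b₁ , refl) , (_ , _ , a , b₀ , refl) })
  (Y ∪ Z) (Down-⊕ Y Z p q)
Down-⊕ (inside ∷ Y) (outside ∷ Z) p q = Down-mono
  (λ { _ (S , T , (a₀ , a₁) , inj₁ b , refl) → (_ , _ , a₀ , b , refl) , (_ , _ , a₁ , b , refl)
     ; _ (S , T , (a₀ , a₁) , inj₂ b , refl) → (_ , _ , a₁ , b , refl) , (_ , _ , a₀ , b , refl) })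
  (Y ∪ Z) (Down-⊕ Y Z p q)
-- It is enough to vary the bit of one summand; the other is fixed at its `outside` version.
Down-⊕ (inside ∷ Y) (inside ∷ Z) p q = Down-mono
  (λ { _ (S , T , (a₀ , a₁) , (b₀ , b₁) , refl) → (_ , _ , a₀ , b₀ , refl) , (_ , _ , a₁ , b₀ , refl) })
  (Y ∪ Z) (Down-⊕ Y Z p q)

-- Together with `Down⇒Shattered` this turns the bound on the VC dimension into a bound on the
-- unions of members of the compressed family.
Down-△Pow : (𝒜 : List (Subset n)) → ∀ Ys → All (Down (_∈ˡ 𝒜)) Ys → Down (△Pow 𝒜 (length Ys)) (⋃ Ys)
Down-△Pow 𝒜 []       []       = Down-⊥ {F = △Pow 𝒜 0} ⊥ ([] , [] , refl)
Down-△Pow 𝒜 (Y ∷ Ys) (p ∷ ps) = Down-mono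
  (λ { _ (S , _ , S∈𝒜 , (Ss , Ss∈𝒜 , refl) , refl) → S ∷ Ss , S∈𝒜 ∷ Ss∈𝒜 , refl })
  (Y ∪ ⋃ Ys) (Down-⊕ Y (⋃ Ys) p (Down-△Pow 𝒜 Ys ps))

-- Truncated binomial sums

-- The strict bound admits the empty sum, which serves as the base of the inductions and covers the
-- case `t = 0`.
binom< : ℕ → ℕ → ℕ
binom< m zero    = 0
binom< m (suc s) = binom≤ m s

binom<-suc : ∀ m s → binom< (suc m) (suc s) ≡ binom< m (suc s) + binom< m s
binom<-suc m zero    = refl
binom<-suc m (suc s) = begin
  binom≤ (suc m) s + suc m C suc s
    ≡⟨ cong₂ _+_ (binom<-suc m s) (sym (nCk+nC[k+1]≡[n+1]C[k+1] m s)) ⟩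
  (binom≤ m s + binom< m s) + (m C s + m C suc s)
    ≡⟨ rearrange (binom≤ m s) (binom< m s) (m C s) (m C suc s) ⟩
  (binom≤ m s + m C suc s) + (binom< m s + m C s)
    ≡⟨ cong (binom≤ m (suc s) +_) (snoc s) ⟩
  (binom≤ m s + m C suc s) + binom≤ m s ∎
  where
  open ≡-Reasoning
  rearrange : ∀ a b c e → (a + b) + (c + e) ≡ (a + e) + (b + c)
  rearrange = solve-∀
  snoc : ∀ s → binom< m s + m C s ≡ binom≤ m s
  snoc zero    = refl
  snoc (suc s) = refl

binom<-monoʳ : ∀ m s → binom< m s ≤ binom< m (suc s)
binom<-monoʳ m zero    = z≤n
binom<-monoʳ m (suc s) = m≤m+n _ _

binom<-+ˡ : ∀ j m s → binom< m s ≤ binom< (j + m) s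
binom<-+ˡ j       m zero    = z≤n
binom<-+ˡ zero    m (suc s) = ≤-refl
binom<-+ˡ (suc j) m (suc s) = ≤-trans (binom<-+ˡ j m (suc s))
  (≤-trans (m≤m+n _ _) (≤-reflexive (sym (binom<-suc (j + m) s))))

binom<-monoˡ : ∀ {m m′} s → m ≤ m′ → binom< m s ≤ binom< m′ s
binom<-monoˡ {m} {m′} s m≤m′ =
  subst (λ j → binom< m s ≤ binom< j s) (m∸n+n≡m m≤m′) (binom<-+ˡ (m′ ∸ m) m s)

-- By Pascal's rule every additional point at most doubles the sum.
binom<-shift : ∀ j m s → binom< (j + m) s ≤ 2 ^ j * binom< m s
binom<-shift j       m zero    = z≤n
binom<-shift zero    m (suc s) = ≤-reflexive (sym (*-identityˡ _))
binom<-shift (suc j) m (suc s) = begin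
  binom< (suc j + m) (suc s)                    ≡⟨ binom<-suc (j + m) s ⟩
  binom< (j + m) (suc s) + binom< (j + m) s     ≤⟨ +-monoʳ-≤ _ (binom<-monoʳ (j + m) s) ⟩
  binom< (j + m) (suc s) + binom< (j + m) (suc s) ≤⟨ +-mono-≤ (binom<-shift j m (suc s)) (binom<-shift j m (suc s)) ⟩
  2 ^ j * x + 2 ^ j * x                         ≡⟨ double (2 ^ j) x ⟩
  2 ^ suc j * x                                 ∎
  where
  open ≤-Reasoning
  x = binom< m (suc s)
  double : ∀ a b → a * b + a * b ≡ (2 * a) * b
  double = solve-∀

-- Induction on `s`: by Pascal's rule the increments in `m` of the two sums are the same two sums
-- for the previous `s`. The `+ 1` is the surplus gained at each increment.
binom<-dominated : ∀ s K → ∃ λ m₀ → ∀ m → m₀ ≤ m → K * binom< m s + 1 ≤ binom< m (suc s)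
binom<-dominated zero    K = 0 , λ m _ → ≤-reflexive (cong (_+ 1) (*-zeroʳ K))
binom<-dominated (suc s) K with binom<-dominated s K
-- At `m₀` the deficit is at most `L`. As many increments make it up, and one more yields the `+ 1`.
... | m₀ , dom = suc L + m₀ , λ m le → subst (λ m → K * f m + 1 ≤ g m) (m∸n+n≡m (≤-trans (m≤n+m m₀ (suc L)) le))
                   (catch-up (m ∸ m₀) (m+n≤o⇒m≤o∸n (suc L) le))
  where
  open ≤-Reasoning
  f = λ m → binom< m (suc s)
  g = λ m → binom< m (suc (suc s))
  L = K * f m₀

  rearrange : ∀ K a b j → K * (a + b) + suc j ≡ (K * a + j) + (K * b + 1)
  rearrange = solve-∀

  swap : ∀ a b c → (a + b) + c ≡ (a + c) + b
  swap = solve-∀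

  -- Each increment of m raises g by at least one more than K f.
  race : ∀ j → K * f (j + m₀) + j ≤ g (j + m₀) + L
  race zero    = ≤-trans (≤-reflexive (+-identityʳ L)) (m≤n+m L _)
  race (suc j) = begin
    K * f (suc j + m₀) + suc j  ≡⟨ cong (λ x → K * x + suc j) (binom<-suc (j + m₀) s) ⟩
    K * (f (j + m₀) + binom< (j + m₀) s) + suc j
      ≡⟨ rearrange K (f (j + m₀)) (binom< (j + m₀) s) j ⟩
    (K * f (j + m₀) + j) + (K * binom< (j + m₀) s + 1)
      ≤⟨ +-mono-≤ (race j) (dom (j + m₀) (m≤n+m m₀ j)) ⟩
    (g (j + m₀) + L) + f (j + m₀)  ≡⟨ swap (g (j + m₀)) L (f (j + m₀)) ⟩
    (g (j + m₀) + f (j + m₀)) + L  ≡⟨ cong (_+ L) (binom<-suc (j + m₀) (suc s)) ⟨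
    g (suc j + m₀) + L             ∎

  catch-up : ∀ j → suc L ≤ j → K * f (j + m₀) + 1 ≤ g (j + m₀)
  catch-up j L<j = +-cancelʳ-≤ L _ _ (begin
    (K * f (j + m₀) + 1) + L  ≡⟨ +-assoc _ 1 L ⟩
    K * f (j + m₀) + suc L    ≤⟨ +-monoʳ-≤ _ L<j ⟩
    K * f (j + m₀) + j        ≤⟨ race j ⟩
    g (j + m₀) + L            ∎)

binom<-eventually : ∀ s r K → ∃ λ n₀ → r ≤ n₀ × ∀ n → n₀ ≤ n → K * binom< n s ≤ binom< (n ∸ r) (suc s)
binom<-eventually s r K with binom<-dominated s (K * 2 ^ r)
... | m₀ , dom = m₀ + r , m≤n+m r m₀ , λ n le → begin
  K * binom< n s                    ≡⟨ cong (λ x → K * binom< x s) (m+[n∸m]≡n (≤-trans (m≤n+m r m₀) le)) ⟨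
  K * binom< (r + (n ∸ r)) s        ≤⟨ *-monoʳ-≤ K (binom<-shift r (n ∸ r) s) ⟩
  K * (2 ^ r * binom< (n ∸ r) s)    ≡⟨ *-assoc K _ _ ⟨
  K * 2 ^ r * binom< (n ∸ r) s      ≤⟨ m≤m+n _ 1 ⟩
  K * 2 ^ r * binom< (n ∸ r) s + 1  ≤⟨ dom (n ∸ r) (m+n≤o⇒m≤o∸n m₀ le) ⟩
  binom< (n ∸ r) (suc s)            ∎
  where open ≤-Reasoning

-- Counting sets close to a given set

binom≤-0ˡ : ∀ s → binom≤ 0 s ≡ 1
binom≤-0ˡ zero    = refl
binom≤-0ˡ (suc s) = trans (+-identityʳ _) (binom≤-0ˡ s)

-- Such a set consists of an arbitrary part of `U` and fewer than `s` points of the complement.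
card-near : ∀ (U : Subset n) s → card (λ S → ∣ S ─ U ∣ <? s) ≤ 2 ^ ∣ U ∣ * binom< ∣ ∁ U ∣ s
card-near U zero = ≤-trans (≤-reflexive (card-empty (λ S → ∣ S ─ U ∣ <? 0) λ _ ())) z≤n
card-near [] (suc s) = ≤-reflexive (sym (trans (*-identityˡ _) (binom≤-0ˡ s)))
card-near (outside ∷ U) (suc s) = begin
  card (λ S → ∣ S ─ U ∣ <? suc s) + card (λ S → suc ∣ S ─ U ∣ <? suc s)
    ≤⟨ +-monoʳ-≤ _ (card-mono _ (λ S → ∣ S ─ U ∣ <? s) (λ _ → s≤s⁻¹)) ⟩
  card (λ S → ∣ S ─ U ∣ <? suc s) + card (λ S → ∣ S ─ U ∣ <? s)
    ≤⟨ +-mono-≤ (card-near U (suc s)) (card-near U s) ⟩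
  a * binom< m (suc s) + a * binom< m s  ≡⟨ *-distribˡ-+ a _ _ ⟨
  a * (binom< m (suc s) + binom< m s)    ≡⟨ cong (a *_) (binom<-suc m s) ⟨
  a * binom< (suc m) (suc s)             ∎
  where
  open ≤-Reasoning
  a = 2 ^ ∣ U ∣
  m = ∣ ∁ U ∣
card-near (inside ∷ U) (suc s) = begin
  card (λ S → ∣ S ─ U ∣ <? suc s) + card (λ S → ∣ S ─ U ∣ <? suc s)
    ≤⟨ +-mono-≤ (card-near U (suc s)) (card-near U (suc s)) ⟩
  a * b + a * b  ≡⟨ double a b ⟩
  (2 * a) * b    ∎
  where
  open ≤-Reasoning
  a = 2 ^ ∣ U ∣
  b = binom< ∣ ∁ U ∣ (suc s)
  double : ∀ a b → a * b + a * b ≡ (2 * a) * b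
  double = solve-∀

Near⊇? : ∀ (R : Subset n) s → Decidable (λ S → ∣ S ─ R ∣ < s × R ⊆ S)
Near⊇? R s S = (∣ S ─ R ∣ <? s) ×-dec (R ⊆? S)

card-near-⊇ : ∀ (R : Subset n) s → binom< ∣ ∁ R ∣ s ≤ card (Near⊇? R s)
card-near-⊇ R  zero    = z≤n
card-near-⊇ [] (suc s) = ≤-reflexive (binom≤-0ˡ s)
card-near-⊇ (outside ∷ R) (suc s) = begin
  binom< (suc m) (suc s)                         ≡⟨ binom<-suc m s ⟩
  binom< m (suc s) + binom< m s                  ≤⟨ +-mono-≤ (card-near-⊇ R (suc s)) (card-near-⊇ R s) ⟩
  card (Near⊇? R (suc s)) + card (Near⊇? R s)    ≤⟨ +-mono-≤
    (card-mono (Near⊇? R (suc s)) (Near⊇? (outside ∷ R) (suc s) ∘ (outside ∷_)) λ _ (p , R⊆S) → p , out⊆ R⊆S)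
    (card-mono (Near⊇? R s) (Near⊇? (outside ∷ R) (suc s) ∘ (inside ∷_)) λ _ (p , R⊆S) → s≤s p , out⊆ R⊆S) ⟩
  card (Near⊇? (outside ∷ R) (suc s))            ∎
  where
  open ≤-Reasoning
  m = ∣ ∁ R ∣
card-near-⊇ (inside ∷ R) (suc s) = begin
  binom< ∣ ∁ R ∣ (suc s)                                   ≤⟨ card-near-⊇ R (suc s) ⟩
  card (Near⊇? R (suc s))                                  ≤⟨ card-mono (Near⊇? R (suc s))
    (Near⊇? (inside ∷ R) (suc s) ∘ (inside ∷_)) (λ _ (p , R⊆S) → p , in⊆in R⊆S) ⟩
  card (Near⊇? (inside ∷ R) (suc s) ∘ (inside ∷_))         ≤⟨ m≤n+m _ (card (Near⊇? (inside ∷ R) (suc s) ∘ (outside ∷_))) ⟩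
  card (Near⊇? (inside ∷ R) (suc s))                       ∎
  where open ≤-Reasoning

-- The union bound. Indices come from `Fin m`, apart from the ground set, so that the induction can
-- shrink `V` while the families stay over `n` points.
card-⋃ : ∀ {m K} (V : Subset m) {P : Fin m → Family n} (P? : ∀ x → Decidable (P x)) (G? : Decidable G) →
         (∀ S → G S → ∃ λ x → x ∈ V × P x S) → (∀ x → x ∈ V → card (P? x) ≤ K) →
         card G? ≤ ∣ V ∣ * K
card-⋃ [] P? G? cover small = ≤-reflexive (card-empty G? λ S g → ¬Fin0 (proj₁ (cover S g)))
card-⋃ (outside ∷ V) {P} P? G? cover small =
  card-⋃ V (P? ∘ suc) G? (λ S g → peel (cover S g)) (λ x x∈V → small (suc x) (there x∈V))
  where
  peel : ∀ {S} → ∃ (λ x → x ∈ outside ∷ V × P x S) → ∃ λ x → x ∈ V × P (suc x) S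
  peel (suc x , there x∈V , p) = x , x∈V , p
card-⋃ {G = G} {K = K} (inside ∷ V) {P} P? G? cover small = begin
  card G?                                    ≤⟨ card-mono G? (P? zero ∪? rest?) split ⟩
  card (P? zero ∪? rest?)                    ≤⟨ card-∪-≤ (P? zero) rest? ⟩
  card (P? zero) + card rest?                ≤⟨ +-mono-≤ (small zero here) (card-⋃ V (P? ∘ suc) rest?
                                                  (λ S (g , ¬p) → peel ¬p (cover S g))
                                                  (λ x x∈V → small (suc x) (there x∈V))) ⟩
  K + ∣ V ∣ * K                              ∎
  where
  open ≤-Reasoning
  rest? = G? ∩? ∁? (P? zero)
  split : ∀ S → G S → P zero S ⊎ (G S × ¬ P zero S)
  split S g with P? zero S
  ... | yes p = inj₁ p
  ... | no ¬p = inj₂ (g , ¬p)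
  peel : ∀ {S} → ¬ P zero S → ∃ (λ x → x ∈ inside ∷ V × P x S) → ∃ λ x → x ∈ V × P (suc x) S
  peel ¬p (zero  , _         , p) = contradiction p ¬p
  peel ¬p (suc x , there x∈V , p) = x , x∈V , p

-- Cardinalities of finite sets

-- Points outside `u` are credited to the first set that brings them in; this adds up the
-- contributions in a greedy choice.
∣p─u∣+∣q─[u∪p]∣ : ∀ (u p q : Subset n) → ∣ p ─ u ∣ + ∣ q ─ (u ∪ p) ∣ ≡ ∣ (p ∪ q) ─ u ∣
∣p─u∣+∣q─[u∪p]∣ [] [] [] = refl
∣p─u∣+∣q─[u∪p]∣ (inside  ∷ u) (_       ∷ p) (_       ∷ q) = ∣p─u∣+∣q─[u∪p]∣ u p q
∣p─u∣+∣q─[u∪p]∣ (outside ∷ u) (inside  ∷ p) (_       ∷ q) = cong suc (∣p─u∣+∣q─[u∪p]∣ u p q)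
∣p─u∣+∣q─[u∪p]∣ (outside ∷ u) (outside ∷ p) (inside  ∷ q) = trans (+-suc _ _) (cong suc (∣p─u∣+∣q─[u∪p]∣ u p q))
∣p─u∣+∣q─[u∪p]∣ (outside ∷ u) (outside ∷ p) (outside ∷ q) = ∣p─u∣+∣q─[u∪p]∣ u p q

∣u∣+∣p─u∣ : ∀ (u p : Subset n) → ∣ u ∣ + ∣ p ─ u ∣ ≡ ∣ u ∪ p ∣
∣u∣+∣p─u∣ [] [] = refl
∣u∣+∣p─u∣ (inside  ∷ u) (_       ∷ p) = cong suc (∣u∣+∣p─u∣ u p)
∣u∣+∣p─u∣ (outside ∷ u) (inside  ∷ p) = trans (+-suc _ _) (cong suc (∣u∣+∣p─u∣ u p))
∣u∣+∣p─u∣ (outside ∷ u) (outside ∷ p) = ∣u∣+∣p─u∣ u p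

∣p∪q∣≤∣p∣+∣q∣ : ∀ (p q : Subset n) → ∣ p ∪ q ∣ ≤ ∣ p ∣ + ∣ q ∣
∣p∪q∣≤∣p∣+∣q∣ p q = ≤-trans (≤-reflexive (sym (∣u∣+∣p─u∣ p q))) (+-monoʳ-≤ ∣ p ∣ (∣p─q∣≤∣p∣ q p))

p⊆q⇒∣p∣+∣q─p∣≤∣q∣ : ∀ {p q : Subset n} → p ⊆ q → ∣ p ∣ + ∣ q ─ p ∣ ≤ ∣ q ∣
p⊆q⇒∣p∣+∣q─p∣≤∣q∣ {p = p} {q} p⊆q = ≤-trans (≤-reflexive (∣u∣+∣p─u∣ p q)) (p⊆q⇒∣p∣≤∣q∣ p∪q⊆q)
  where
  p∪q⊆q : p ∪ q ⊆ q
  p∪q⊆q x∈ with x∈p∪q⁻ p q x∈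
  ... | inj₁ x∈p = p⊆q x∈p
  ... | inj₂ x∈q = x∈q

x∈p─q⇒x∉q : ∀ (p q : Subset n) {x} → x ∈ p ─ q → x ∉ q
x∈p─q⇒x∉q (_ ∷ p) (inside  ∷ q) (there x∈) (there x∈q) = x∈p─q⇒x∉q p q x∈ x∈q
x∈p─q⇒x∉q (_ ∷ p) (outside ∷ q) (there x∈) (there x∈q) = x∈p─q⇒x∉q p q x∈ x∈q

∪-mono-⊆ : ∀ {p p′ q q′ : Subset n} → p ⊆ p′ → q ⊆ q′ → p ∪ q ⊆ p′ ∪ q′
∪-mono-⊆ {p = p} {q = q} p⊆p′ q⊆q′ x∈ with x∈p∪q⁻ p q x∈
... | inj₁ x∈p = x∈p∪q⁺ (inj₁ (p⊆p′ x∈p))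
... | inj₂ x∈q = x∈p∪q⁺ (inj₂ (q⊆q′ x∈q))

superset-of-size : ∀ (V : Subset n) r → ∣ V ∣ ≤ r → r ≤ n → ∃ λ R → V ⊆ R × ∣ R ∣ ≡ r
superset-of-size []           zero    _         _         = [] , id , refl
superset-of-size (inside ∷ V) (suc r) (s≤s V≤r) (s≤s r≤n) with superset-of-size V r V≤r r≤n
... | R , V⊆R , eq = inside ∷ R , in⊆in V⊆R , cong suc eq
superset-of-size {suc n} (outside ∷ V) r V≤r r≤1+n with r ≤? n
... | yes r≤n with R , V⊆R , eq ← superset-of-size V r V≤r r≤n = outside ∷ R , out⊆ V⊆R , eq
-- Here `r` equals `suc n`, so only the full set has the right size.
... | no r≰n  = ⊤ , ⊆⊤ , trans (∣⊤∣≡n (suc n)) (≤-antisym (≰⇒> r≰n) r≤1+n)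

⋃-⁅suc⁆ : ∀ (xs : List (Fin n)) → ⋃ (map ⁅_⁆ (map suc xs)) ≡ outside ∷ ⋃ (map ⁅_⁆ xs)
⋃-⁅suc⁆ []       = refl
⋃-⁅suc⁆ (x ∷ xs) = cong (⁅ suc x ⁆ ∪_) (⋃-⁅suc⁆ xs)

-- Distinctness of the points is recorded by the size of the union of their singletons.
choose : ∀ (V : Subset n) j → j ≤ ∣ V ∣ →
         ∃ λ xs → length xs ≡ j × All (_∈ V) xs × ∣ ⋃ (map ⁅_⁆ xs) ∣ ≡ j
choose {n} V zero _ = [] , refl , [] , ∣⊥∣≡0 n
choose (outside ∷ V) (suc j) j<V with choose V (suc j) j<V
... | xs , len , xs∈V , eq =
  map suc xs , trans (length-map suc xs) len , All.map⁺ (mapAll there xs∈V) , trans (cong ∣_∣ (⋃-⁅suc⁆ xs)) eq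
choose (inside ∷ V) (suc j) (s≤s j≤V) with choose V j j≤V
... | xs , len , xs∈V , eq =
  zero ∷ map suc xs , cong suc (trans (length-map suc xs) len) , here ∷ All.map⁺ (mapAll there xs∈V) ,
  trans (cong (λ p → ∣ ⁅ zero ⁆ ∪ p ∣) (⋃-⁅suc⁆ xs)) (cong suc (trans (cong ∣_∣ (∪-identityˡ (⋃ (map ⁅_⁆ xs)))) eq))

⋃-replicate-⊥-++ : ∀ e (Ss : List (Subset n)) → ⋃ (replicate e ⊥ ++ Ss) ≡ ⋃ Ss
⋃-replicate-⊥-++ zero    Ss = refl
⋃-replicate-⊥-++ (suc e) Ss = trans (∪-identityˡ _) (⋃-replicate-⊥-++ e Ss)

-- The size bound settles the case of no copies, where it forces `R` to be empty.
⊆-⋃-replicate : ∀ k (R : Subset n) → ∣ R ∣ ≤ k → R ⊆ ⋃ (replicate k R)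
⊆-⋃-replicate zero    R R≤0 x∈R = contradiction (≤-trans (x∈p⇒∣p-x∣<∣p∣ x∈R) R≤0) λ ()
⊆-⋃-replicate (suc k) R _   x∈R = p⊆p∪q _ x∈R

-- Families with bounded unions

-- The number of sets united is `suc k`. The bound `c` leaves room for avoiding up to `suc k` points
-- together with `suc k` members of size at most `d`.
module BoundedUnions {n k d t r c : ℕ} (d≡ : d ≡ r + t * suc k) (r≤k : r ≤ k) (c≥ : suc k + suc k * d ≤ c)
  {A : Family n} (A? : Decidable A)
  (unions : ∀ Ss → length Ss ≡ suc k → All A Ss → ∣ ⋃ Ss ∣ ≤ d) where

  open ≤-Reasoning

  too-large : ∀ {x} → x ≤ d → ¬ r + t * suc k < x
  too-large x≤d = ≤⇒≯ (≤-trans x≤d (≤-reflexive d≡))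

  -- Light and heavy sets

  Escapes : ℕ → Subset n → Subset n → Family n
  Escapes s M U S = A S × M ⊆ S × s ≤ ∣ S ─ U ∣

  Escapes? : ∀ s M U → Decidable (Escapes s M U)
  Escapes? s M U S = A? S ×-dec M ⊆? S ×-dec s ≤? ∣ S ─ U ∣

  -- `Heavy` is the negation of `Light`, phrased so as to yield witnesses; finite search passes from
  -- one to the other.
  Light Heavy : ℕ → Subset n → Set
  Light s M = ∃ λ U → ∣ U ∣ ≤ c × ¬ ∃ (Escapes s M U)
  Heavy s M = ∀ U → ∣ U ∣ ≤ c → ∃ (Escapes s M U)

  light? : ∀ s M → Dec (Light s M)
  light? s M = anySubset? λ U → ∣ U ∣ ≤? c ×-dec ¬? (anySubset? (Escapes? s M U))

  ¬light⇒heavy : ∀ {s M} → ¬ Light s M → Heavy s M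
  ¬light⇒heavy ¬light U U≤c = decidable-stable (anySubset? (Escapes? _ _ U)) λ ¬e → ¬light (U , U≤c , ¬e)

  light-card : ∀ {s M} → Light s M → card (A? ∩? (M ⊆?_)) ≤ 2 ^ c * binom< n s
  light-card {s} {M} (U , U≤c , ¬e) = begin
    card (A? ∩? (M ⊆?_))           ≤⟨ card-mono (A? ∩? (M ⊆?_)) (λ S → ∣ S ─ U ∣ <? s) (λ S (a , M⊆S) → ≰⇒> λ s≤ → ¬e (S , a , M⊆S , s≤)) ⟩
    card (λ S → ∣ S ─ U ∣ <? s)    ≤⟨ card-near U s ⟩
    2 ^ ∣ U ∣ * binom< ∣ ∁ U ∣ s   ≤⟨ *-mono-≤ (^-monoʳ-≤ 2 U≤c) (binom<-monoˡ s (∣p∣≤n (∁ U))) ⟩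
    2 ^ c * binom< n s             ∎

  -- The sets united may coincide, so `suc k` copies of `S` qualify.
  size≤d : ∀ {S} → A S → ∣ S ∣ ≤ d
  size≤d {S} a = ≤-trans (∣p∣≤∣p∪q∣ S _) (unions (replicate (suc k) S) (length-replicate (suc k)) (All.replicate⁺ (suc k) a))

  Spread : ℕ → List (Subset n) → Subset n → Set
  Spread s Ms U = ∃ λ Ss → length Ss ≡ length Ms × All A Ss × ⋃ Ms ⊆ ⋃ Ss × length Ms * s ≤ ∣ ⋃ Ss ─ U ∣

  -- Greedy choice: heaviness of `M` gives a member with `s` points outside `U`, which is then added
  -- to the set to avoid. Each choice enlarges that set by at most `d`, within the budget `c`.
  escape : ∀ {s} Ms → All (Heavy s) Ms → ∀ U → ∣ U ∣ + length Ms * d ≤ c → Spread s Ms U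
  escape []       []       U _  = [] , refl , [] , id , z≤n
  escape {s} (M ∷ Ms) (h ∷ hs) U le
    with S , a , M⊆S , s≤ ← h U (≤-trans (m≤m+n _ _) le)
    with Ss , len , as , Ms⊆Ss , ms≤ ← escape Ms hs (U ∪ S) (begin
      ∣ U ∪ S ∣ + length Ms * d        ≤⟨ +-monoˡ-≤ _ (∣p∪q∣≤∣p∣+∣q∣ U S) ⟩
      (∣ U ∣ + ∣ S ∣) + length Ms * d  ≤⟨ +-monoˡ-≤ _ (+-monoʳ-≤ ∣ U ∣ (size≤d a)) ⟩
      (∣ U ∣ + d) + length Ms * d      ≡⟨ +-assoc ∣ U ∣ d _ ⟩
      ∣ U ∣ + (d + length Ms * d)      ≤⟨ le ⟩
      c                                ∎)
    = S ∷ Ss , cong suc len , a ∷ as , ∪-mono-⊆ M⊆S Ms⊆Ss ,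
      ≤-trans (+-mono-≤ s≤ ms≤) (≤-reflexive (∣p─u∣+∣q─[u∪p]∣ U S (⋃ Ss)))

  -- Otherwise `suc k` members could each contribute `suc t` new points, and `suc k * suc t` exceeds
  -- `d` because `r ≤ k`. The witness is a bounded set outside which every member has at most `t`
  -- points.
  ⊥-light : Light (suc t) ⊥
  ⊥-light = decidable-stable (light? (suc t) ⊥) λ ¬light →
    absurd (escape Ms (All.replicate⁺ (suc k) (¬light⇒heavy ¬light)) ⊥ (begin
      ∣ ⊥ {n} ∣ + length Ms * d  ≡⟨ cong₂ (λ x y → x + y * d) (∣⊥∣≡0 n) lenMs ⟩
      suc k * d                  ≤⟨ m≤n+m _ (suc k) ⟩
      suc k + suc k * d          ≤⟨ c≥ ⟩
      c                          ∎))
    where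
    Ms = replicate (suc k) ⊥
    lenMs : length Ms ≡ suc k
    lenMs = length-replicate (suc k)
    absurd : ¬ Spread (suc t) Ms ⊥
    absurd (Ss , len , as , _ , large) = too-large (unions Ss (trans len lenMs) as) (begin-strict
      r + t * suc k        <⟨ +-monoˡ-< (t * suc k) (s≤s r≤k) ⟩
      suc t * suc k        ≡⟨ *-comm (suc t) (suc k) ⟩
      suc k * suc t        ≡⟨ cong (_* suc t) lenMs ⟨
      length Ms * suc t    ≤⟨ large ⟩
      ∣ ⋃ Ss ─ ⊥ ∣         ≤⟨ ∣p─q∣≤∣p∣ (⋃ Ss) ⊥ ⟩
      ∣ ⋃ Ss ∣             ∎)

  -- Heavy points

  heavyPoints : Subset n
  heavyPoints = tabulate λ x → does (¬? (light? t ⁅ x ⁆))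

  ∈heavyPoints⇒heavy : ∀ {x} → x ∈ heavyPoints → Heavy t ⁅ x ⁆
  ∈heavyPoints⇒heavy {x} x∈ with light? t ⁅ x ⁆ | trans (sym (Vec.lookup∘tabulate _ x)) (Vec.[]=⇒lookup x∈)
  ... | no ¬light | _ = ¬light⇒heavy ¬light

  ∉heavyPoints⇒light : ∀ {x} → x ∉ heavyPoints → Light t ⁅ x ⁆
  ∉heavyPoints⇒light {x} x∉ = decidable-stable (light? t ⁅ x ⁆) λ ¬light →
    x∉ (Vec.lookup⇒[]= x heavyPoints (trans (Vec.lookup∘tabulate _ x) (cong-does ¬light)))
    where
    cong-does : ¬ Light t ⁅ x ⁆ → does (¬? (light? t ⁅ x ⁆)) ≡ inside
    cong-does ¬light with light? t ⁅ x ⁆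
    ... | yes l = contradiction l ¬light
    ... | no _  = refl

  heavy-⊥ : ∀ {M} → Heavy t M → Heavy t ⊥
  heavy-⊥ h U U≤c with S , a , _ , le ← h U U≤c = S , a , ⊥⊆ , le

  -- If `suc r` points were heavy, members covering them would have a union with these points and
  -- `t * suc k` others, more than `d` in all.
  ∣heavyPoints∣≤r : ∣ heavyPoints ∣ ≤ r
  ∣heavyPoints∣≤r = ≮⇒≥ λ r<∣H∣ → absurd (choose heavyPoints (suc r) r<∣H∣)
    where
    absurd : ¬ ∃ λ xs → length xs ≡ suc r × All (_∈ heavyPoints) xs × ∣ ⋃ (map ⁅_⁆ xs) ∣ ≡ suc r
    absurd (xs@(x ∷ _) , lenxs , xs∈@(x∈ ∷ _) , size) =
      -- Avoiding the chosen points from the start keeps them out of the count of new points.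
      overfull (escape Ms heavyMs (⋃ Ms) (begin
        ∣ ⋃ Ms ∣ + length Ms * d  ≡⟨ cong₂ (λ x y → x + y * d) sizeMs lenMs ⟩
        suc r + suc k * d         ≤⟨ +-monoˡ-≤ _ (s≤s r≤k) ⟩
        suc k + suc k * d         ≤⟨ c≥ ⟩
        c                         ∎))
      where
      -- Empty sets pad the `suc r` singletons to `suc k` sets; the empty set is heavy as soon as
      -- some set is.
      Ms = replicate (k ∸ r) ⊥ ++ map ⁅_⁆ xs
      sizeMs : ∣ ⋃ Ms ∣ ≡ suc r
      sizeMs = trans (cong ∣_∣ (⋃-replicate-⊥-++ (k ∸ r) (map ⁅_⁆ xs))) size
      lenMs : length Ms ≡ suc k
      lenMs = begin-equality
        length Ms          ≡⟨ length-++ (replicate (k ∸ r) ⊥) ⟩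
        length (replicate (k ∸ r) (⊥ {n})) + length (map ⁅_⁆ xs)
          ≡⟨ cong₂ _+_ (length-replicate (k ∸ r)) (trans (length-map ⁅_⁆ xs) lenxs) ⟩
        (k ∸ r) + suc r    ≡⟨ +-suc (k ∸ r) r ⟩
        suc (k ∸ r + r)    ≡⟨ cong suc (m∸n+n≡m r≤k) ⟩
        suc k              ∎
      heavyMs : All (Heavy t) Ms
      heavyMs = All.++⁺ (All.replicate⁺ (k ∸ r) (heavy-⊥ (∈heavyPoints⇒heavy x∈)))
                        (All.map⁺ (mapAll ∈heavyPoints⇒heavy xs∈))
      overfull : ¬ Spread t Ms (⋃ Ms)
      overfull (Ss , len , as , Ms⊆Ss , large) = too-large (unions Ss (trans len lenMs) as) (begin-strict
        r + t * suc k                        <⟨ n<1+n _ ⟩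
        suc r + t * suc k                    ≡⟨ cong₂ _+_ (sym sizeMs) (*-comm t (suc k)) ⟩
        ∣ ⋃ Ms ∣ + suc k * t                 ≡⟨ cong (λ x → ∣ ⋃ Ms ∣ + x * t) lenMs ⟨
        ∣ ⋃ Ms ∣ + length Ms * t             ≤⟨ +-monoʳ-≤ ∣ ⋃ Ms ∣ large ⟩
        ∣ ⋃ Ms ∣ + ∣ ⋃ Ss ─ ⋃ Ms ∣           ≤⟨ p⊆q⇒∣p∣+∣q─p∣≤∣q∣ Ms⊆Ss ⟩
        ∣ ⋃ Ss ∣                             ∎)

  -- Otherwise `S` and `k` members containing `R`, each with `t` new points, have a union of size at
  -- least `r + suc t + k * t`, which is `suc d`.
  heavy⇒near : ∀ R → ∣ R ∣ ≡ r → Heavy t R → ∀ S → A S → ∣ S ─ R ∣ < suc t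
  heavy⇒near R R≡r h S a = ≰⇒> λ t<S─R → absurd t<S─R
    (escape (replicate k R) (All.replicate⁺ k h) (R ∪ S) (begin
      ∣ R ∪ S ∣ + length (replicate k R) * d  ≤⟨ +-mono-≤ (∣p∪q∣≤∣p∣+∣q∣ R S) (≤-reflexive (cong (_* d) lenR)) ⟩
      (∣ R ∣ + ∣ S ∣) + k * d                 ≤⟨ +-monoˡ-≤ _ (+-mono-≤ R≤k (size≤d a)) ⟩
      (k + d) + k * d                         ≡⟨ +-assoc k d _ ⟩
      k + suc k * d                           ≤⟨ n≤1+n _ ⟩
      suc k + suc k * d                       ≤⟨ c≥ ⟩
      c                                       ∎))
    where
    lenR = length-replicate k {x = R}
    R≤k : ∣ R ∣ ≤ k
    R≤k = ≤-trans (≤-reflexive R≡r) r≤k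
    rearrange : ∀ r t k → suc (r + t * suc k) ≡ r + (suc t + k * t)
    rearrange = solve-∀
    absurd : suc t ≤ ∣ S ─ R ∣ → ¬ Spread t (replicate k R) (R ∪ S)
    absurd t<S─R (Ss , len , as , Rs⊆Ss , large) =
      too-large (unions (S ∷ Ss) (cong suc (trans len lenR)) (a ∷ as)) (begin
        suc (r + t * suc k)                            ≡⟨ rearrange r t k ⟩
        r + (suc t + k * t)                            ≡⟨ cong₂ (λ x y → x + (suc t + y * t)) R≡r lenR ⟨
        ∣ R ∣ + (suc t + length (replicate k R) * t)   ≤⟨ +-monoʳ-≤ ∣ R ∣ (+-mono-≤ t<S─R large) ⟩
        ∣ R ∣ + (∣ S ─ R ∣ + ∣ ⋃ Ss ─ (R ∪ S) ∣)       ≡⟨ cong (∣ R ∣ +_) (∣p─u∣+∣q─[u∪p]∣ R S (⋃ Ss)) ⟩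
        ∣ R ∣ + ∣ (S ∪ ⋃ Ss) ─ R ∣                     ≤⟨ p⊆q⇒∣p∣+∣q─p∣≤∣q∣ R⊆ ⟩
        ∣ S ∪ ⋃ Ss ∣                                   ∎)
      where
      R⊆ : R ⊆ S ∪ ⋃ Ss
      -- `R` is covered by the members chosen for its copies, since `S` may fail to contain it.
      R⊆ x∈R = q⊆p∪q S (⋃ Ss) (Rs⊆Ss (⊆-⋃-replicate k R R≤k x∈R))

  -- The final count

  ∣∁∣≡ : ∀ (R : Subset n) → ∣ R ∣ ≡ r → ∣ ∁ R ∣ ≡ n ∸ r
  ∣∁∣≡ R R≡r = trans (∣∁p∣≡n∸∣p∣ R) (cong (n ∸_) R≡r)

  near-card : ∀ R → ∣ R ∣ ≡ r → card (λ S → ∣ S ─ R ∣ <? suc t) ≤ 2 ^ r * binom≤ (n ∸ r) t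
  near-card R R≡r = subst₂ (λ x y → card (λ S → ∣ S ─ R ∣ <? suc t) ≤ 2 ^ x * binom≤ y t)
    R≡r (∣∁∣≡ R R≡r) (card-near R (suc t))

  -- Members that contain `R` or are far from it are traded for the near sets containing `R`, which
  -- are at least as numerous. With the near sets not containing `R` these make up all near sets.
  light-bound : suc c * 2 ^ c * binom< n t ≤ binom< (n ∸ r) (suc t) →
                ∀ {R} → heavyPoints ⊆ R → ∣ R ∣ ≡ r → Light t R → Light (suc t) ⊥ →
                card A? ≤ 2 ^ r * binom≤ (n ∸ r) t
  light-bound dominated {R} H⊆R R≡r R-light (U , U≤c , ¬escapes) = begin
    card A?
      ≤⟨ card-mono A? (lower? ∪? (above? ∪? far?)) split ⟩
    card (lower? ∪? (above? ∪? far?))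
      ≤⟨ ≤-trans (card-∪-≤ lower? (above? ∪? far?)) (+-monoʳ-≤ _ (card-∪-≤ above? far?)) ⟩
    card lower? + (card above? + card far?)
      ≤⟨ +-monoʳ-≤ (card lower?) (+-mono-≤ (light-card R-light) far-card) ⟩
    -- One `K` bounds the members above `R`; the other `c` come from the at most `c` points of
    -- `U ─ R`.
    card lower? + (K + c * K)
      ≡⟨ cong (card lower? +_) (*-assoc (suc c) (2 ^ c) (binom< n t)) ⟨
    card lower? + suc c * 2 ^ c * binom< n t
      ≤⟨ +-monoʳ-≤ _ dominated ⟩
    card lower? + binom< (n ∸ r) (suc t)
      ≤⟨ +-monoʳ-≤ _ (subst (λ x → binom< x (suc t) ≤ card (Near⊇? R (suc t))) (∣∁∣≡ R R≡r) (card-near-⊇ R (suc t))) ⟩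
    card lower? + card (Near⊇? R (suc t))
      ≤⟨ card-disjoint lower? (Near⊇? R (suc t)) near? (λ _ → proj₁) (λ _ → proj₁) (λ _ p q → proj₂ p (proj₂ q)) ⟩
    card near?
      ≤⟨ near-card R R≡r ⟩
    2 ^ r * binom≤ (n ∸ r) t  ∎
    where
    K = 2 ^ c * binom< n t
    near? = λ S → ∣ S ─ R ∣ <? suc t
    lower? = near? ∩? ∁? (R ⊆?_)
    above? = A? ∩? (R ⊆?_)
    far? = A? ∩? ∁? near?

    split : ∀ S → A S → (∣ S ─ R ∣ < suc t × ¬ R ⊆ S) ⊎ (A S × R ⊆ S) ⊎ (A S × ¬ ∣ S ─ R ∣ < suc t)
    split S a with R ⊆? S | near? S
    ... | yes R⊆S | _        = inj₂ (inj₁ (a , R⊆S))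
    ... | no R⊈S  | yes near = inj₁ (near , R⊈S)
    ... | no _    | no ¬near = inj₂ (inj₂ (a , ¬near))

    -- A far set has too few elements outside U, so it meets U outside R.
    meets : ∀ S → A S × ¬ ∣ S ─ R ∣ < suc t → ∃ λ x → x ∈ (U ─ R) × A S × ⁅ x ⁆ ⊆ S
    meets S (a , ¬near) with nonempty? ((S ─ R) ∩ U)
    ... | yes (x , x∈) = x , x∈p∧x∉q⇒x∈p─q x∈U (x∈p─q⇒x∉q S R x∈S─R) , a ,
                         λ y∈ → subst (_∈ S) (sym (x∈⁅y⁆⇒x≡y x y∈)) (p─q⊆p S R x∈S─R)
      where
      x∈S─R = proj₁ (x∈p∩q⁻ (S ─ R) U x∈)
      x∈U = proj₂ (x∈p∩q⁻ (S ─ R) U x∈)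
    ... | no empty = ⊥-elim (¬escapes (S , a , ⊥⊆ , ≤-trans (≮⇒≥ ¬near) (p⊆q⇒∣p∣≤∣q∣ S─R⊆S─U)))
      where
      S─R⊆S─U : S ─ R ⊆ S ─ U
      S─R⊆S─U {x} x∈ = x∈p∧x∉q⇒x∈p─q (p─q⊆p S R x∈) λ x∈U → empty (x , x∈p∩q⁺ (x∈ , x∈U))

    far-card : card far? ≤ c * K
    far-card = ≤-trans
      (card-⋃ (U ─ R) (λ x → A? ∩? (⁅ x ⁆ ⊆?_)) far? meets
        -- All heavy points lie in `R`, so every point of `U ─ R` is light.
        (λ x x∈ → light-card (∉heavyPoints⇒light (x∈p─q⇒x∉q U R x∈ ∘ H⊆R))))
      (*-monoˡ-≤ K (≤-trans (∣p─q∣≤∣p∣ U R) U≤c))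

  bound : r ≤ n → suc c * 2 ^ c * binom< n t ≤ binom< (n ∸ r) (suc t) → card A? ≤ 2 ^ r * binom≤ (n ∸ r) t
  bound r≤n dominated with superset-of-size heavyPoints r ∣heavyPoints∣≤r r≤n
  ... | R , H⊆R , R≡r with light? t R
  ... | yes R-light = light-bound dominated H⊆R R≡r R-light ⊥-light
  ... | no ¬light   = ≤-trans
    (card-mono A? (λ S → ∣ S ─ R ∣ <? suc t) (heavy⇒near R R≡r (¬light⇒heavy ¬light)))
    (near-card R R≡r)

-- Application to the compressed family

theorem3 : (k d : ℕ) → ⦃ _ : NonZero k ⦄ → 1 ≤ d →
    ∃ λ n₀ → ∀ n → n₀ ≤ n → (𝒜 : List (Subset n)) → Unique 𝒜 →
    VC≤ (△Pow 𝒜 k) d →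
    length 𝒜 ≤ 2 ^ (d % k) * binom≤ (n ∸ d % k) (d / k)
theorem3 (suc k) d _ =
  proj₁ eventually , λ n n₀≤n 𝒜 unique vc →
    let unions : ∀ Ss → length Ss ≡ suc k → All (Down (_∈ˡ 𝒜)) Ss → ∣ ⋃ Ss ∣ ≤ d
        unions Ss len Ss∈ = vc (⋃ Ss) (Down⇒Shattered (⋃ Ss)
          (subst (λ j → Down (△Pow 𝒜 j) (⋃ Ss)) len (Down-△Pow 𝒜 Ss Ss∈)))
    in ≤-trans (length≤card 𝒜 unique)
      (≤-trans (≤-reflexive (sym (card-Down (_∈ˡ? 𝒜))))
        (BoundedUnions.bound {t = d / suc k} (m≡m%n+[m/n]*n d (suc k)) (s≤s⁻¹ (m%n<n d (suc k))) ≤-refl (Down? (_∈ˡ? 𝒜)) unions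
          (≤-trans (proj₁ (proj₂ eventually)) n₀≤n) (proj₂ (proj₂ eventually) n n₀≤n)))
  where
  -- The constants depend on `d` and `k` alone, hence so does the threshold for `n`.
  c = suc k + suc k * d
  eventually = binom<-eventually (d / suc k) (d % suc k) (suc c * 2 ^ c)
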